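{- Let $M$ be a set system on $[n]$. Then $M$ is a strong $\Delta$-matroid if and only if it has no peerless antipode in any $k$-cube for $k\ge3$.
   Context: A set system on $[n]=\{1,\dots,n\}$ is a (possibly empty) collection of subsets of $[n]$; $\triangle$ is symmetric difference (when $a=b$, $\{a,b\}=\{a\}$). A $\Delta$-matroid is a set system $M$ such that for all $A,B\in M$ and $a\in A\triangle B$ there exists $b\in A\triangle B$ (possibly $b=a$) with $A\triangle\{a,b\}\in M$. A $\Delta$-matroid $M$ is strong if it satisfies the hyperplane exchange property: for all distinct $A,B\in M$ there exist (possibly equal) $a,b\in A\triangle B$ such that $A\triangle\{a,b\}\in M$ and $B\triangle\{a,b\}\in M$. For $S\subseteq[n]$ let $\varepsilon_S\in\mathbb R^n$ be its indicator vector. For $I,J\subseteq[n]$ let $\square_{I,J}=\operatorname{conv}\{\varepsilon_S: I\cap J\subseteq S\subseteq I\cup J\}$; it is a $k$-cube when $|I\triangle J|=k$. An antipode of $\square_{I,J}$ is a pair $(S,T)$ with $S\cap T=I\cap J$ and $S\triangle T=I\triangle J$. For $I,J\in M$, $(I,J)$ is a peerless antipode of $M$ in $\square_{I,J}$ if whenever $S,T\in M$ satisfy $S\cap T=I\cap J$ and $S\triangle T=I\triangle J$, then $\{S,T\}=\{I,J\}$. "$M$ has a peerless antipode in a $k$-cube" means there are $I,J\in M$ with $|I\triangle J|=k$ such that $(I,J)$ is a peerless antipode of $M$ in $\square_{I,J}$. -}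

module Defs where

open import Data.Bool.Base using (Bool; _xor_)
open import Data.Fin.Base using (Fin)
open import Data.Fin.Subset using (Subset; inside; _∈_; _∪_; _∩_; ⁅_⁆; ∣_∣)
open import Data.Nat.Base using (ℕ)
open import Data.Product.Base using (Σ-syntax; _×_)
open import Data.Sum.Base using (_⊎_)
open import Data.Vec.Base using (zipWith)
open import Relation.Binary.PropositionalEquality.Core using (_≡_; _≢_)

-- The ground set [n] is Fin n.  As with Subset itself, a collection of
-- subsets is given by its characteristic function.

SetSystem : ℕ → Set
SetSystem n = Subset n → Bool

module _ {n : ℕ} where

  infix  4 _∈ˢ_
  infixl 6 _△_

  _∈ˢ_ : Subset n → SetSystem n → Set
  S ∈ˢ M = M S ≡ inside

  _△_ : Subset n → Subset n → Subset n
  _△_ = zipWith _xor_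

  -- The set {a, b}, which is {a} when a and b coincide.
  ⁅_,_⁆ : Fin n → Fin n → Subset n
  ⁅ a , b ⁆ = ⁅ a ⁆ ∪ ⁅ b ⁆

  IsDeltaMatroid : SetSystem n → Set
  IsDeltaMatroid M =
    ∀ (A B : Subset n) → A ∈ˢ M → B ∈ˢ M →
    ∀ (a : Fin n) → a ∈ A △ B →
    Σ[ b ∈ Fin n ] (b ∈ A △ B × A △ ⁅ a , b ⁆ ∈ˢ M)

  HyperplaneExchange : SetSystem n → Set
  HyperplaneExchange M =
    ∀ (A B : Subset n) → A ∈ˢ M → B ∈ˢ M → A ≢ B →
    Σ[ a ∈ Fin n ] Σ[ b ∈ Fin n ]
      (a ∈ A △ B × b ∈ A △ B ×
       A △ ⁅ a , b ⁆ ∈ˢ M × B △ ⁅ a , b ⁆ ∈ˢ M)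

  IsStrongDeltaMatroid : SetSystem n → Set
  IsStrongDeltaMatroid M = IsDeltaMatroid M × HyperplaneExchange M

  -- The cube □_{I,J} = conv {ε_S : I ∩ J ⊆ S ⊆ I ∪ J} enters only through its
  -- antipodes, which are pairs of vertices, so it is represented by (I , J).
  IsAntipode : (I J S T : Subset n) → Set
  IsAntipode I J S T = S ∩ T ≡ I ∩ J × S △ T ≡ I △ J

  -- Equality {S, T} = {I, J} of unordered pairs.
  SamePair : (S T I J : Subset n) → Set
  SamePair S T I J = (S ≡ I × T ≡ J) ⊎ (S ≡ J × T ≡ I)

  -- (I , J) is a peerless antipode of M in □_{I,J}.
  IsPeerless : SetSystem n → (I J : Subset n) → Set
  IsPeerless M I J =
    I ∈ˢ M × J ∈ˢ M ×
    (∀ (S T : Subset n) → S ∈ˢ M → T ∈ˢ M →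
     IsAntipode I J S T → SamePair S T I J)

  -- The dimension of □_{I,J} is ∣ I △ J ∣.
  HasPeerlessAntipodeInCube : SetSystem n → ℕ → Set
  HasPeerlessAntipodeInCube M k =
    Σ[ I ∈ Subset n ] Σ[ J ∈ Subset n ] (∣ I △ J ∣ ≡ k × IsPeerless M I J)

{-# OPTIONS --safe #-}
module Submission where

-- Only "no peerless antipode implies strong" needs work, and there the stronger
-- simultaneous exchange holds: for A, B ∈ M and every a ∈ A △ B some b ∈ A △ B
-- has both A △ {a, b} and B △ {a, b} in M.  Induct on the size of D = A △ B; by
-- symmetry take A = ∅.  In a counterexample the sets
--   P = {r : {a, r} ∈ M}   and   Q = {q : D \ {a, q} ∈ M}
-- are disjoint (r = a or q = a stands for {a}), and complementing in D we may
-- take a ∉ Q.  A peer S ∋ a of ∅ gives g = D \ S with D \ g ∈ M and a ∉ g.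
-- Exchanging a between ∅ and D \ g, and then between D and the result, replaces
-- some q ∈ g ∩ Q by some r ∈ P, where r = a means that q is just deleted.  So
-- |g ∩ Q| falls until g = {q} with q ∈ Q and a ∈ P.  Exchanging q between {a}
-- and D gives y with {a, q, y} and D \ {q, y} in M.  If y ∉ Q, the same swapping
-- applied to {q, y} leads to a g disjoint from Q, which is impossible.  If
-- y ∈ Q, then {q, y} ∈ M, and a set h ∈ M inside Q keeps growing by
-- exchanges until it shows D \ {a} ⊆ Q.  So no {a, r} with r ≠ a is in M, whence
-- {a} ∪ X ∈ M forces |X| to be even; but X = D \ {a} and X = D \ {a, q} both occur.

open import Defs
open import Algebra.Bundles using (CommutativeRing)
open import Algebra.Lattice.Properties.BooleanAlgebra using (module XorRing)
import Algebra.Properties.CommutativeSemigroup as CommutativeSemigroupProperties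
open import Data.Bool.Base using (Bool; true; false; not; _∧_; _∨_; _xor_)
open import Data.Bool.Properties as Bool using (xor-∧-commutativeRing)
open import Data.Empty using (⊥-elim) renaming (⊥ to ⊥₀)
open import Data.Fin.Base using (Fin; zero; suc)
open import Data.Fin.Properties as Fin using (any?)
open import Data.Fin.Subset
  using (Subset; inside; ⊥; _∈_; _∉_; _⊆_; _∩_; _∪_; ∁; ⁅_⁆; ∣_∣; Nonempty)
open import Data.Fin.Subset.Properties
open import Data.Nat.Base using (ℕ; zero; suc; _+_; _≤_; _<_; _≥_; z≤n; s≤s; s≤s⁻¹)
open import Data.Nat.Properties as ℕ
  using (≤-trans; ≤-reflexive; <-≤-trans; ≤-<-trans; n<1+n; ≰⇒>)
open import Data.Product.Base using (Σ-syntax; _×_; _,_; proj₁; proj₂)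
open import Data.Sum.Base using (_⊎_; inj₁; inj₂; [_,_]′)
open import Data.Vec.Base using (Vec; []; _∷_; here; there; lookup; tabulate; foldr′)
open import Data.Vec.Properties as Vec using (lookup⇒[]=; []=⇒lookup; lookup∘tabulate)
open import Function.Base using (_∘_; id)
open import Function.Bundles using (_⇔_; mk⇔)
open import Relation.Binary.PropositionalEquality as ≡
  using (_≡_; _≢_; refl; sym; trans; cong; cong₂; subst; module ≡-Reasoning)
import Relation.Binary.Reflection as Reflection
open import Relation.Nullary.Decidable using (Dec; yes; no; ¬?; _×-dec_)
open import Relation.Nullary.Negation.Core using (¬_; contradiction)
open import Relation.Unary using (Decidable)

-- Symmetric difference as the addition of a Boolean ring, with a solver.

xor-def : ∀ x y → (x xor y) ≡ (x ∨ y) ∧ not (x ∧ y)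
xor-def false y     = sym (Bool.∧-identityʳ y)
xor-def true  false = refl
xor-def true  true  = refl

△-def : ∀ {n} (S T : Subset n) → S △ T ≡ (S ∪ T) ∩ ∁ (S ∩ T)
△-def []      []      = refl
△-def (x ∷ S) (y ∷ T) = cong₂ _∷_ (xor-def x y) (△-def S T)

module △-Solver {n : ℕ} where

  △-∩-commutativeRing : CommutativeRing _ _
  △-∩-commutativeRing = XorRing.⊕-∧-commutativeRing (∪-∩-booleanAlgebra n) _△_ △-def

  open CommutativeRing △-∩-commutativeRing
    using (+-identityˡ; +-identityʳ; -‿inverseʳ; +-assoc; +-commutativeSemigroup)
  open CommutativeSemigroupProperties +-commutativeSemigroup using (interchange; x∙yz≈y∙xz)

  infixl 6 _:△_

  data Sum (k : ℕ) : Set where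
    var  : Fin k → Sum k
    :⊥   : Sum k
    _:△_ : Sum k → Sum k → Sum k

  ⟦_⟧ : ∀ {k} → Sum k → Vec (Subset n) k → Subset n
  ⟦ var i  ⟧ ρ = lookup ρ i
  ⟦ :⊥     ⟧ ρ = ⊥
  ⟦ e :△ f ⟧ ρ = ⟦ e ⟧ ρ △ ⟦ f ⟧ ρ

  -- Since △ has exponent two, a sum is determined by the set of variables
  -- that occur in it an odd number of times.
  odd : ∀ {k} → Sum k → Subset k
  odd (var i)  = ⁅ i ⁆
  odd :⊥       = ⊥
  odd (e :△ f) = odd e △ odd f

  sum : ∀ {k} → Subset k → Vec (Subset n) k → Subset n
  sum []          []      = ⊥
  sum (false ∷ s) (_ ∷ ρ) = sum s ρ
  sum (true  ∷ s) (v ∷ ρ) = v △ sum s ρ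

  private
    sum-⊥ : ∀ {k} (ρ : Vec (Subset n) k) → sum ⊥ ρ ≡ ⊥
    sum-⊥ []      = refl
    sum-⊥ (_ ∷ ρ) = sum-⊥ ρ

    sum-⁅⁆ : ∀ {k} (i : Fin k) ρ → sum ⁅ i ⁆ ρ ≡ lookup ρ i
    sum-⁅⁆ zero    (v ∷ ρ) = trans (cong (v △_) (sum-⊥ ρ)) (+-identityʳ v)
    sum-⁅⁆ (suc i) (_ ∷ ρ) = sum-⁅⁆ i ρ

    sum-△ : ∀ {k} (s t : Subset k) ρ → sum (s △ t) ρ ≡ sum s ρ △ sum t ρ
    sum-△ []          []          []      = sym (+-identityˡ ⊥)
    sum-△ (false ∷ s) (false ∷ t) (_ ∷ ρ) = sum-△ s t ρ
    sum-△ (false ∷ s) (true  ∷ t) (v ∷ ρ) =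
      trans (cong (v △_) (sum-△ s t ρ)) (x∙yz≈y∙xz v (sum s ρ) (sum t ρ))
    sum-△ (true  ∷ s) (false ∷ t) (v ∷ ρ) =
      trans (cong (v △_) (sum-△ s t ρ)) (sym (+-assoc v (sum s ρ) (sum t ρ)))
    sum-△ (true  ∷ s) (true  ∷ t) (v ∷ ρ) = sym (
      trans (interchange v (sum s ρ) v (sum t ρ))
      (trans (cong₂ _△_ (-‿inverseʳ v) (sym (sum-△ s t ρ))) (+-identityˡ _)))

    correct : ∀ {k} (e : Sum k) ρ → sum (odd e) ρ ≡ ⟦ e ⟧ ρ
    correct (var i)  ρ = sum-⁅⁆ i ρ
    correct :⊥       ρ = sum-⊥ ρ
    correct (e :△ f) ρ = trans (sum-△ (odd e) (odd f) ρ) (cong₂ _△_ (correct e ρ) (correct f ρ))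

  -- On closed formal sums `odd` computes, so equal normal forms agree by `refl`.
  open Reflection (≡.setoid (Subset n)) var ⟦_⟧ (sum ∘ odd) correct public
    using (solve) renaming (_⊜_ to infix 4 _:=_)

open △-Solver using (solve; :⊥; _:△_; _:=_)

module _ {n : ℕ} where

  △-⊥ : ∀ (S : Subset n) → S △ ⊥ ≡ S
  △-⊥ = solve 1 (λ s → s :△ :⊥ := s) refl

  △-cancel : ∀ (S T : Subset n) → S △ (S △ T) ≡ T
  △-cancel = solve 2 (λ s t → s :△ (s :△ t) := t) refl

-- Membership and size under `△`; for `S ⊆ D`, `D △ S` is the complement of `S` in `D`.

∈-△⁻ : ∀ {n} (S T : Subset n) {x} → x ∈ S △ T → (x ∈ S × x ∉ T) ⊎ (x ∉ S × x ∈ T)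
∈-△⁻ (true  ∷ _) (false ∷ _) here = inj₁ (here , λ ())
∈-△⁻ (false ∷ _) (true  ∷ _) here = inj₂ ((λ ()) , here)
∈-△⁻ (_ ∷ S) (_ ∷ T) (there p) with ∈-△⁻ S T p
... | inj₁ (x∈S , x∉T) = inj₁ (there x∈S , λ where (there x∈T) → x∉T x∈T)
... | inj₂ (x∉S , x∈T) = inj₂ ((λ where (there x∈S) → x∉S x∈S) , there x∈T)

∈-△ˡ : ∀ {n} {S T : Subset n} {x} → x ∈ S → x ∉ T → x ∈ S △ T
∈-△ˡ {T = false ∷ _} here      _   = here
∈-△ˡ {T = true  ∷ _} here      x∉T = contradiction here x∉T
∈-△ˡ {T = _ ∷ _}     (there p) x∉T = there (∈-△ˡ p (x∉T ∘ there))

∈-△ʳ : ∀ {n} {S T : Subset n} {x} → x ∉ S → x ∈ T → x ∈ S △ T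
∈-△ʳ {S = false ∷ _} _   here      = here
∈-△ʳ {S = true  ∷ _} x∉S here      = contradiction here x∉S
∈-△ʳ {S = _ ∷ _}     x∉S (there p) = there (∈-△ʳ (x∉S ∘ there) p)

module _ {n : ℕ} {S T : Subset n} {x : Fin n} where

  ∈-△⇒∈⊎∈ : x ∈ S △ T → x ∈ S ⊎ x ∈ T
  ∈-△⇒∈⊎∈ x∈ with ∈-△⁻ S T x∈
  ... | inj₁ (x∈S , _) = inj₁ x∈S
  ... | inj₂ (_ , x∈T) = inj₂ x∈T

  ∉-△ : x ∉ S → x ∉ T → x ∉ S △ T
  ∉-△ x∉S x∉T x∈ = [ x∉S , x∉T ]′ (∈-△⇒∈⊎∈ x∈)

  ∈-△-∉ʳ : x ∈ S △ T → x ∉ T → x ∈ S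
  ∈-△-∉ʳ x∈ x∉T = [ id , (λ x∈T → contradiction x∈T x∉T) ]′ (∈-△⇒∈⊎∈ x∈)

  ∈⇒∉-△ : x ∈ S → x ∈ T → x ∉ S △ T
  ∈⇒∉-△ x∈S x∈T x∈ with ∈-△⁻ S T x∈
  ... | inj₁ (_ , x∉T) = x∉T x∈T
  ... | inj₂ (x∉S , _) = x∉S x∈S

module _ {n : ℕ} {D S : Subset n} where

  △-⊆ : ∀ {T} → S ⊆ D → T ⊆ D → S △ T ⊆ D
  △-⊆ S⊆D T⊆D x∈ = [ S⊆D , T⊆D ]′ (∈-△⇒∈⊎∈ x∈)

  ∈-∖⁻ : ∀ {x} → S ⊆ D → x ∈ D △ S → x ∈ D × x ∉ S
  ∈-∖⁻ S⊆D x∈ with ∈-△⁻ D S x∈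
  ... | inj₁ p           = p
  ... | inj₂ (x∉D , x∈S) = contradiction (S⊆D x∈S) x∉D

⁅x⁆⊆ : ∀ {n} {x : Fin n} {S} → x ∈ S → ⁅ x ⁆ ⊆ S
⁅x⁆⊆ {x = x} x∈S y∈ with refl ← x∈⁅y⁆⇒x≡y x y∈ = x∈S

∣∖∣ : ∀ {n} {D S : Subset n} → S ⊆ D → ∣ D △ S ∣ + ∣ S ∣ ≡ ∣ D ∣
∣∖∣ {D = []}        {[]}        _   = refl
∣∖∣ {D = false ∷ _} {false ∷ _} S⊆D = ∣∖∣ (drop-∷-⊆ S⊆D)
∣∖∣ {D = false ∷ _} {true  ∷ _} S⊆D with () ← S⊆D here
∣∖∣ {D = true  ∷ _} {false ∷ _} S⊆D = cong suc (∣∖∣ (drop-∷-⊆ S⊆D))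
∣∖∣ {D = true  ∷ D} {true  ∷ S} S⊆D =
  trans (ℕ.+-suc ∣ D △ S ∣ ∣ S ∣) (cong suc (∣∖∣ (drop-∷-⊆ S⊆D)))

∣△⁅x⁆∣-∈ : ∀ {n} (S : Subset n) {x} → x ∈ S → suc ∣ S △ ⁅ x ⁆ ∣ ≡ ∣ S ∣
∣△⁅x⁆∣-∈ S {x} x∈S = begin
  suc ∣ S △ ⁅ x ⁆ ∣          ≡⟨ ℕ.+-comm 1 _ ⟩
  ∣ S △ ⁅ x ⁆ ∣ + 1          ≡⟨ cong (∣ S △ ⁅ x ⁆ ∣ +_) (∣⁅x⁆∣≡1 x) ⟨
  ∣ S △ ⁅ x ⁆ ∣ + ∣ ⁅ x ⁆ ∣  ≡⟨ ∣∖∣ (⁅x⁆⊆ x∈S) ⟩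
  ∣ S ∣                      ∎
  where open ≡-Reasoning

∣△⁅x⁆∣-∉ : ∀ {n} (S : Subset n) {x} → x ∉ S → ∣ S △ ⁅ x ⁆ ∣ ≡ suc ∣ S ∣
∣△⁅x⁆∣-∉ S {x} x∉S =
  trans (sym (∣△⁅x⁆∣-∈ (S △ ⁅ x ⁆) (∈-△ʳ x∉S (x∈⁅x⁆ x))))
        (cong (suc ∘ ∣_∣) (solve 2 (λ s x → (s :△ x) :△ x := s) refl S ⁅ x ⁆))

∣△⁅x⁆∣-≤ : ∀ {n} (S : Subset n) x → ∣ S △ ⁅ x ⁆ ∣ ≤ suc ∣ S ∣
∣△⁅x⁆∣-≤ S x with x ∈? S
... | yes x∈S = ℕ.m≤n⇒m≤1+n (≤-trans (ℕ.n≤1+n _) (≤-reflexive (∣△⁅x⁆∣-∈ S x∈S)))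
... | no  x∉S = ≤-reflexive (∣△⁅x⁆∣-∉ S x∉S)

module _ {n : ℕ} (S D : Subset n) where

  ∣∣-< : S ⊆ D → ∀ {x} → x ∈ D → x ∉ S → ∣ S ∣ < ∣ D ∣
  ∣∣-< S⊆D x∈D x∉S = p⊂q⇒∣p∣<∣q∣ (S⊆D , _ , x∈D , x∉S)

  ⊆∧≮⇒≡ : S ⊆ D → ¬ ∣ S ∣ < ∣ D ∣ → S ≡ D
  ⊆∧≮⇒≡ S⊆D ≮ = ⊆-antisym S⊆D D⊆S
    where
    D⊆S : D ⊆ S
    D⊆S {x} x∈D with x ∈? S
    ... | yes x∈S = x∈S
    ... | no  x∉S = contradiction (∣∣-< S⊆D x∈D x∉S) ≮

  ∣∖∣-< : S ⊆ D → ∀ {x} → x ∈ S → ∣ D △ S ∣ < ∣ D ∣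
  ∣∖∣-< S⊆D {x} x∈S = p⊂q⇒∣p∣<∣q∣ (△-⊆ id S⊆D , x , S⊆D x∈S , ∈⇒∉-△ (S⊆D x∈S) x∈S)

∈⇒0<∣∣ : ∀ {n} (S : Subset n) {x} → x ∈ S → 0 < ∣ S ∣
∈⇒0<∣∣ S x∈S = subst (0 <_) (∣△⁅x⁆∣-∈ S x∈S) (s≤s z≤n)

-- Parity of the size of a set.

parity : ∀ {n} → Subset n → Bool
parity = foldr′ _xor_ false

parity-△ : ∀ {n} (S T : Subset n) → parity (S △ T) ≡ (parity S xor parity T)
parity-△ []      []      = refl
parity-△ (x ∷ S) (y ∷ T) =
  trans (cong ((x xor y) xor_) (parity-△ S T)) (interchange x y (parity S) (parity T))
  where open CommutativeSemigroupProperties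
          (CommutativeRing.+-commutativeSemigroup xor-∧-commutativeRing) using (interchange)

parity-⊥ : ∀ n → parity (⊥ {n}) ≡ false
parity-⊥ zero    = refl
parity-⊥ (suc n) = parity-⊥ n

parity-⁅⁆ : ∀ {n} (x : Fin n) → parity ⁅ x ⁆ ≡ true
parity-⁅⁆ {suc n} zero    = cong not (parity-⊥ n)
parity-⁅⁆         (suc x) = parity-⁅⁆ x

parity-△⁅⁆ : ∀ {n} (S : Subset n) x → parity (S △ ⁅ x ⁆) ≡ not (parity S)
parity-△⁅⁆ S x = trans (parity-△ S ⁅ x ⁆)
                (trans (cong (parity S xor_) (parity-⁅⁆ x)) (Bool.xor-comm (parity S) true))

-- Mates, exchange and twisting.

module _ {n : ℕ} where

  -- A set {a, b} with a, b ∈ D is written ⁅ a ⁆ △ R with Mate D a R, so that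
  -- the case a ≡ b becomes R ≡ ⊥ and every set in sight is a sum under △.
  data Mate (D : Subset n) (a : Fin n) : Subset n → Set where
    alone : Mate D a ⊥
    mate  : ∀ {r} → r ∈ D → r ≢ a → Mate D a ⁅ r ⁆

  module _ {D : Subset n} {a : Fin n} where

    mate-∈ : ∀ {R x} → Mate D a R → x ∈ R → x ∈ D × x ≢ a
    mate-∈ alone              x∈R = contradiction x∈R ∉⊥
    mate-∈ (mate {r} r∈D r≢a) x∈R with refl ← x∈⁅y⁆⇒x≡y r x∈R = r∈D , r≢a

    a∉mate : ∀ {R} → Mate D a R → a ∉ R
    a∉mate m a∈R = proj₂ (mate-∈ m a∈R) refl

    ∣△mate∣-≤ : ∀ S {R} → Mate D a R → ∣ S △ R ∣ ≤ suc ∣ S ∣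
    ∣△mate∣-≤ S alone      = ℕ.m≤n⇒m≤1+n (≤-reflexive (cong ∣_∣ (△-⊥ S)))
    ∣△mate∣-≤ S (mate _ _) = ∣△⁅x⁆∣-≤ S _

    mate-mono : ∀ {E R} → D ⊆ E → Mate D a R → Mate E a R
    mate-mono D⊆E alone          = alone
    mate-mono D⊆E (mate r∈D r≢a) = mate (D⊆E r∈D) r≢a

    anyMate? : {P : Subset n → Set} → Decidable P → Dec (Σ[ R ∈ Subset n ] (Mate D a R × P R))
    anyMate? P? with P? ⊥ | any? (λ r → (r ∈? D) ×-dec ¬? (r Fin.≟ a) ×-dec P? ⁅ r ⁆)
    ... | yes p | _                        = yes (⊥ , alone , p)
    ... | no  _ | yes (r , r∈D , r≢a , p)  = yes (⁅ r ⁆ , mate r∈D r≢a , p)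
    ... | no ¬p | no  ¬q                   = no λ where
      (_ , alone        , p) → ¬p p
      (_ , mate r∈D r≢a , p) → ¬q (_ , r∈D , r≢a , p)

  -- A pair of members is given as `A` and `A △ D`, so that twisting leaves `D` unchanged and the
  -- induction can run on `∣ D ∣`.
  Exchange : SetSystem n → Subset n → Subset n → Fin n → Set
  Exchange F A D a =
    Σ[ R ∈ Subset n ] (Mate D a R × A △ ⁅ a ⁆ △ R ∈ˢ F × A △ D △ ⁅ a ⁆ △ R ∈ˢ F)

  infix 4 _≟ˢ_ _∉ˢ_ _∈ˢ?_

  _≟ˢ_ : ∀ (S T : Subset n) → Dec (S ≡ T)
  _≟ˢ_ = Vec.≡-dec Bool._≟_

  _∉ˢ_ : Subset n → SetSystem n → Set
  S ∉ˢ F = ¬ S ∈ˢ F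

  _∈ˢ?_ : ∀ S (F : SetSystem n) → Dec (S ∈ˢ F)
  S ∈ˢ? F = F S Bool.≟ inside

  -- Twisting by `A` moves `A` to `⊥`; twisting by `D` complements the subsets of `D`.
  twist : Subset n → SetSystem n → SetSystem n
  twist A F S = F (A △ S)

-- The minimal counterexample, moved so that its pair is `⊥` and `D`.

module Counterexample {n : ℕ} (F : SetSystem n) (D : Subset n) (a : Fin n)
  (exchange : ∀ A E {x} → A ∈ˢ F → A △ E ∈ˢ F → ∣ E ∣ < ∣ D ∣ → x ∈ E → Exchange F A E x)
  (∅∈F : ⊥ ∈ˢ F) (D∈F : D ∈ˢ F) (a∈D : a ∈ D)
  -- No partner serves `a`: this is the disjointness of P and Q.
  (clash : ∀ {R} → Mate D a R → ⁅ a ⁆ △ R ∈ˢ F → D △ ⁅ a ⁆ △ R ∉ˢ F)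
  (D△a∉F : D △ ⁅ a ⁆ ∉ˢ F)
  where

  private
    _≈>_ : ∀ {S T} → S ∈ˢ F → S ≡ T → T ∈ˢ F
    S∈F ≈> S≡T = subst (_∈ˢ F) S≡T S∈F

  exchange-cases : ∀ A E {x} {C : Set} → A ∈ˢ F → A △ E ∈ˢ F → ∣ E ∣ < ∣ D ∣ → x ∈ E →
    (A △ ⁅ x ⁆ ∈ˢ F → A △ E △ ⁅ x ⁆ ∈ˢ F → C) →
    (∀ {r} → r ∈ E → r ≢ x → A △ ⁅ x ⁆ △ ⁅ r ⁆ ∈ˢ F → A △ E △ ⁅ x ⁆ △ ⁅ r ⁆ ∈ˢ F → C) → C
  exchange-cases A E A∈F B∈F small x∈E single double with exchange A E A∈F B∈F small x∈E
  ... | _ , alone        , p , q = single (p ≈> △-⊥ _) (q ≈> △-⊥ _)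
  ... | _ , mate r∈E r≢x , p , q = double r∈E r≢x p q

  -- At `q = a` the formula collapses to `D`, so `Q a` holds and says nothing about `D △ ⁅ a ⁆`. It
  -- is consulted only at elements other than `a`; that `a` lies outside Q is `D△a∉F`.
  Q : Fin n → Set
  Q q = D △ ⁅ a ⁆ △ ⁅ q ⁆ ∈ˢ F

  opaque
    Q-set : Subset n
    Q-set = tabulate (λ q → F (D △ ⁅ a ⁆ △ ⁅ q ⁆))

    ∈Q-set⁺ : ∀ {q} → Q q → q ∈ Q-set
    ∈Q-set⁺ {q} Qq = lookup⇒[]= q Q-set (trans (lookup∘tabulate _ q) Qq)

    ∈Q-set⁻ : ∀ {q} → q ∈ Q-set → Q q
    ∈Q-set⁻ {q} q∈ = trans (sym (lookup∘tabulate _ q)) ([]=⇒lookup q∈)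

  mate⇒¬Q : ∀ {R x} → Mate D a R → ⁅ a ⁆ △ R ∈ˢ F → x ∈ R → ¬ Q x
  mate⇒¬Q alone              _ x∈R = contradiction x∈R ∉⊥
  mate⇒¬Q (mate {r} r∈D r≢a) p x∈R with refl ← x∈⁅y⁆⇒x≡y r x∈R = clash (mate r∈D r≢a) p

  -- `g` is the complement in `D` of a member containing `a`; the empty set qualifies because of `D`
  -- itself.
  record Removable (g : Subset n) : Set where
    constructor removable
    field
      g⊆D   : g ⊆ D
      a∉g   : a ∉ g
      D△g∈F : D △ g ∈ˢ F

  open Removable

  -- Exchanges `a` between `⊥` and `D △ g`. The mate comes from outside `g`, so `a` and `R` join the
  -- removed set.
  raise : ∀ {g} → Removable g → Nonempty g →
    Σ[ R ∈ Subset n ] (Mate (D △ g) a R × ⁅ a ⁆ △ R ∈ˢ F × D △ (g △ ⁅ a ⁆ △ R) ∈ˢ F)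
  raise {g} rg (x , x∈g) =
    let R , m , p , q = exchange ⊥ (D △ g) ∅∈F
          (D△g∈F rg ≈> solve 1 (λ s → s := :⊥ :△ s) refl (D △ g))
          (∣∖∣-< g D (g⊆D rg) x∈g) (∈-△ˡ a∈D (a∉g rg))
    in R , m
    , (p ≈> solve 2 (λ a r → (:⊥ :△ a) :△ r := a :△ r) refl ⁅ a ⁆ R)
    , (q ≈> solve 4 (λ d g a r → ((:⊥ :△ (d :△ g)) :△ a) :△ r := d :△ ((g :△ a) :△ r))
              refl D g ⁅ a ⁆ R)

  mate⊆ : ∀ {g R} → g ⊆ D → Mate (D △ g) a R → Mate D a R
  mate⊆ g⊆D = mate-mono (proj₁ ∘ ∈-∖⁻ g⊆D)

  -- Exchanges `a` between `D` and the set found by `raise`. Deleting `a` alone from `D` is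
  -- excluded, so there is a partner `q`, and it is in Q. As `R` misses Q, `q` comes from `g`; in
  -- the other set `a` and `q` are put back.
  swap : ∀ {g R} → Removable g → Mate (D △ g) a R → ⁅ a ⁆ △ R ∈ˢ F →
    D △ (g △ ⁅ a ⁆ △ R) ∈ˢ F → ∣ g △ ⁅ a ⁆ △ R ∣ < ∣ D ∣ →
    Σ[ q ∈ Fin n ] (q ∈ g × Q q × Removable (g △ ⁅ q ⁆ △ R))
  swap {g} {R} rg m p s small =
    exchange-cases D (g △ ⁅ a ⁆ △ R) D∈F s small a∈
      (λ D△a∈F _ → contradiction D△a∈F D△a∉F)
      (λ {q} q∈ q≢a Qq s′ →
        let q∈g = ∈-△-∉ʳ (∈-△-∉ʳ q∈ (λ q∈R → mate⇒¬Q m′ p q∈R Qq)) (x≢y⇒x∉⁅y⁆ q≢a)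
        in q , q∈g , Qq , record
          { g⊆D   = △-⊆ (△-⊆ (g⊆D rg) (⁅x⁆⊆ (g⊆D rg q∈g))) (proj₁ ∘ mate-∈ m′)
          ; a∉g   = ∉-△ (∉-△ (a∉g rg) (x≢y⇒x∉⁅y⁆ (q≢a ∘ sym))) (a∉mate m)
          ; D△g∈F = s′ ≈> solve 5 (λ d g a r q → ((d :△ ((g :△ a) :△ r)) :△ a) :△ q
                                                   := d :△ ((g :△ q) :△ r))
                            refl D g ⁅ a ⁆ R ⁅ q ⁆
          })
    where
    m′ : Mate D a R
    m′ = mate⊆ (g⊆D rg) m
    a∈ : a ∈ g △ ⁅ a ⁆ △ R
    a∈ = ∈-△ˡ (∈-△ʳ (a∉g rg) (x∈⁅x⁆ a)) (a∉mate m)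

  ∣g△a△R∣< : ∀ {g R} → Mate (D △ g) a R → 2 + ∣ g ∣ < ∣ D ∣ → ∣ g △ ⁅ a ⁆ △ R ∣ < ∣ D ∣
  ∣g△a△R∣< {g} m = ≤-<-trans (≤-trans (∣△mate∣-≤ (g △ ⁅ a ⁆) m) (s≤s (∣△⁅x⁆∣-≤ g a)))

  removable-meets-Q : ∀ {g} → Removable g → Nonempty g → 2 + ∣ g ∣ < ∣ D ∣ →
    ¬ (∀ {x} → x ∈ g → ¬ Q x)
  removable-meets-Q rg ne small ¬Q =
    let _ , m , p , s    = raise rg ne
        q , q∈g , Qq , _ = swap rg m p s (∣g△a△R∣< m small)
    in ¬Q q∈g Qq

  -- Each swap takes an element of Q out of `g` and inserts none, while `∣ g ∣` never grows; this
  -- goes on until the next `g` would be empty.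
  removable-singleton : ∀ k {g} → ∣ g ∩ Q-set ∣ < k →
    Removable g → Nonempty g → 2 + ∣ g ∣ < ∣ D ∣ →
    ⁅ a ⁆ ∈ˢ F × Σ[ q ∈ Fin n ] (q ∈ D × q ≢ a × Q q × D △ ⁅ q ⁆ ∈ˢ F)
  removable-singleton (suc k) {g} fuel rg ne small =
    let _ , m , p , s      = raise rg ne
        _ , q∈g , Qq , rg′ = swap rg m p s (∣g△a△R∣< m small)
    in continue m p q∈g Qq rg′ (nonempty? _)
    where
    continue : ∀ {R q} → Mate (D △ g) a R → ⁅ a ⁆ △ R ∈ˢ F → q ∈ g → Q q →
      Removable (g △ ⁅ q ⁆ △ R) → Dec (Nonempty (g △ ⁅ q ⁆ △ R)) →
      ⁅ a ⁆ ∈ˢ F × Σ[ q ∈ Fin n ] (q ∈ D × q ≢ a × Q q × D △ ⁅ q ⁆ ∈ˢ F)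
    continue {R} {q} m p q∈g Qq rg′ (yes ne′) =
      removable-singleton k (<-≤-trans shrinks (s≤s⁻¹ fuel)) rg′ ne′
        (≤-<-trans (s≤s (s≤s (≤-trans (∣△mate∣-≤ (g △ ⁅ q ⁆) m) (≤-reflexive (∣△⁅x⁆∣-∈ g q∈g))))) small)
      where
      g′ : Subset n
      g′ = g △ ⁅ q ⁆ △ R
      g′∩Q⊆g∩Q : g′ ∩ Q-set ⊆ g ∩ Q-set
      g′∩Q⊆g∩Q x∈ =
        let x∈g′ , x∈Q = x∈p∩q⁻ g′ Q-set x∈
            x∈g△q = ∈-△-∉ʳ x∈g′ (λ x∈R → mate⇒¬Q (mate⊆ (g⊆D rg) m) p x∈R (∈Q-set⁻ x∈Q))
        in x∈p∩q⁺ ([ id , ⁅x⁆⊆ q∈g ]′ (∈-△⇒∈⊎∈ x∈g△q) , x∈Q)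
      q∉g′ : q ∉ g′
      q∉g′ = ∉-△ (∈⇒∉-△ q∈g (x∈⁅x⁆ q))
                 (λ q∈R → proj₂ (∈-∖⁻ (g⊆D rg) (proj₁ (mate-∈ m q∈R))) q∈g)
      shrinks : ∣ g′ ∩ Q-set ∣ < ∣ g ∩ Q-set ∣
      shrinks = ∣∣-< (g′ ∩ Q-set) (g ∩ Q-set) g′∩Q⊆g∩Q (x∈p∩q⁺ (q∈g , ∈Q-set⁺ Qq))
                     (q∉g′ ∘ proj₁ ∘ x∈p∩q⁻ g′ Q-set)
    -- The inserted `r` lies outside `g`, so the new set still contains it.
    continue (mate {r} r∈ _) _ q∈g _ _ (no empty) =
      contradiction (r , ∈-△ʳ (∉-△ r∉g (r∉g ∘ ⁅x⁆⊆ q∈g)) (x∈⁅x⁆ r)) empty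
      where
      r∉g = proj₂ (∈-∖⁻ (g⊆D rg) r∈)
    continue {q = q} alone p q∈g Qq _ (no empty) =
      (p ≈> △-⊥ _) , q , g⊆D rg q∈g , (λ q≡a → a∉g rg (subst (_∈ g) q≡a q∈g)) , Qq
      , (D△g∈F rg ≈> cong (D △_) g≡⁅q⁆)
      where
      open ≡-Reasoning
      g≡⁅q⁆ : g ≡ ⁅ q ⁆
      g≡⁅q⁆ = begin
        g                      ≡⟨ solve 2 (λ g q → g := ((g :△ q) :△ :⊥) :△ q) refl g ⁅ q ⁆ ⟩
        g △ ⁅ q ⁆ △ ⊥ △ ⁅ q ⁆  ≡⟨ cong (_△ ⁅ q ⁆) (Empty-unique empty) ⟩
        ⊥ △ ⁅ q ⁆              ≡⟨ solve 1 (λ q → :⊥ :△ q := q) refl ⁅ q ⁆ ⟩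
        ⁅ q ⁆                  ∎

  -- Members of `F` inside Q.

  record InQ (x : Fin n) : Set where
    constructor inQ
    field
      x∈D : x ∈ D
      x≢a : x ≢ a
      Qx  : Q x

  open InQ

  adjoin : ∀ {h r} → (∀ {x} → x ∈ h → InQ x) → InQ r → ∀ {x} → x ∈ h △ ⁅ r ⁆ → InQ x
  adjoin {r = r} h⊆Q r∈Q x∈ with ∈-△⇒∈⊎∈ x∈
  ... | inj₁ x∈h = h⊆Q x∈h
  ... | inj₂ x∈r with refl ← x∈⁅y⁆⇒x≡y r x∈r = r∈Q

  -- Exchanges `a` between `h` and `D`. On the side of `D`, `a` alone is excluded, and a partner `r`
  -- is in Q by definition.
  enlarge : ∀ {h} → h ∈ˢ F → Nonempty h → (∀ {x} → x ∈ h → InQ x) →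
    Σ[ r ∈ Fin n ] (r ∈ D △ h × InQ r × h △ ⁅ r ⁆ △ ⁅ a ⁆ ∈ˢ F)
  enlarge {h} h∈F (y , y∈h) h⊆Q =
    exchange-cases h (D △ h) h∈F
         (D∈F ≈> solve 2 (λ d h → d := h :△ (d :△ h)) refl D h)
         (∣∖∣-< h D (x∈D ∘ h⊆Q) y∈h)
         (∈-△ˡ a∈D (λ a∈h → x≢a (h⊆Q a∈h) refl))
      (λ _ s → contradiction
         (s ≈> solve 3 (λ d h a → (h :△ (d :△ h)) :△ a := d :△ a) refl D h ⁅ a ⁆) D△a∉F)
      (λ {r} r∈ r≢a p s → r , r∈
         , inQ (proj₁ (∈-∖⁻ (x∈D ∘ h⊆Q) r∈)) r≢a
               (s ≈> solve 4 (λ d h a r → ((h :△ (d :△ h)) :△ a) :△ r := (d :△ a) :△ r)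
                       refl D h ⁅ a ⁆ ⁅ r ⁆)
         , (p ≈> solve 3 (λ h a r → (h :△ a) :△ r := (h :△ r) :△ a) refl h ⁅ a ⁆ ⁅ r ⁆))

  -- After `enlarge`, exchanging `a` between `⊥` and the enlarged set deletes `a` again, since a
  -- partner would be in both P and Q. What remains is a larger member inside Q.
  Q-spreads : ∀ k {h} → ∣ D △ h ∣ < k → h ∈ˢ F → Nonempty h → (∀ {x} → x ∈ h → InQ x) →
    ∀ {x} → x ∈ D → x ≢ a → Q x
  Q-spreads (suc k) {h} fuel h∈F ne h⊆Q =
    let _ , r∈ , r∈Q , s = enlarge h∈F ne h⊆Q in Step.spread r∈ r∈Q s (_ ℕ.<? _)
    where
    module Step {r} (r∈ : r ∈ D △ h) (r∈Q : InQ r) (s : h △ ⁅ r ⁆ △ ⁅ a ⁆ ∈ˢ F) where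
      h′ : Subset n
      h′ = h △ ⁅ r ⁆

      h′⊆Q : ∀ {x} → x ∈ h′ → InQ x
      h′⊆Q = adjoin h⊆Q r∈Q

      h′△a⊆D : h′ △ ⁅ a ⁆ ⊆ D
      h′△a⊆D = △-⊆ (x∈D ∘ h′⊆Q) (⁅x⁆⊆ a∈D)

      Q-h′△a : ∀ {x} → x ∈ h′ △ ⁅ a ⁆ → x ≢ a → Q x
      Q-h′△a x∈ x≢a = Qx (h′⊆Q (∈-△-∉ʳ x∈ (x≢y⇒x∉⁅y⁆ x≢a)))

      shrinks : suc ∣ D △ h′ ∣ ≡ ∣ D △ h ∣
      shrinks = trans (cong (suc ∘ ∣_∣) (solve 3 (λ d h r → d :△ (h :△ r) := (d :△ h) :△ r)
                                           refl D h ⁅ r ⁆))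
                      (∣△⁅x⁆∣-∈ (D △ h) r∈)

      spread : Dec (∣ h′ △ ⁅ a ⁆ ∣ < ∣ D ∣) → ∀ {x} → x ∈ D → x ≢ a → Q x
      -- The enlarged set is all of `D`, and its elements other than `a` are in Q.
      spread (no ≮) x∈D = Q-h′△a (subst (_ ∈_) (sym (⊆∧≮⇒≡ (h′ △ ⁅ a ⁆) D h′△a⊆D ≮)) x∈D)
      spread (yes small) =
        exchange-cases ⊥ (h′ △ ⁅ a ⁆) ∅∈F
             (s ≈> solve 1 (λ s → s := :⊥ :△ s) refl (h′ △ ⁅ a ⁆)) small
             (∈-△ʳ (λ a∈h′ → x≢a (h′⊆Q a∈h′) refl) (x∈⁅x⁆ a))
          (λ _ s′ → Q-spreads k (<-≤-trans (≤-reflexive shrinks) (s≤s⁻¹ fuel))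
             (s′ ≈> solve 2 (λ h a → (:⊥ :△ (h :△ a)) :△ a := h) refl h′ ⁅ a ⁆)
             (r , ∈-△ʳ (proj₂ (∈-∖⁻ (x∈D ∘ h⊆Q) r∈)) (x∈⁅x⁆ r)) h′⊆Q)
          (λ {z} z∈ z≢a p _ → contradiction (Q-h′△a z∈ z≢a)
             (clash (mate (h′△a⊆D z∈) z≢a)
                    (p ≈> solve 2 (λ a z → (:⊥ :△ a) :△ z := a :△ z) refl ⁅ a ⁆ ⁅ z ⁆)))

  -- The parity contradiction.

  module _ (a∈F : ⁅ a ⁆ ∈ˢ F) (all-Q : ∀ {x} → x ∈ D → x ≢ a → Q x) where

    -- As no {a, x} is in F, every exchange from {a} towards {a} ∪ X uses two
    -- elements of X.
    even : ∀ k {X} → ∣ X ∣ < k → X ⊆ D → a ∉ X → ⁅ a ⁆ △ X ∈ˢ F → parity X ≡ false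
    even (suc k) {X} fuel X⊆D a∉X aX∈F with nonempty? X
    ... | no empty = trans (cong parity (Empty-unique empty)) (parity-⊥ n)
    ... | yes (x , x∈X) =
      exchange-cases ⁅ a ⁆ X a∈F aX∈F (∣∣-< X D X⊆D a∈D a∉X) x∈X
        (λ p _ → contradiction (all-Q (X⊆D x∈X) x≢a′) (clash (mate (X⊆D x∈X) x≢a′) p))
        (λ y∈X y≢x _ s → trans (sym (parity-X _))
          (even k (<-≤-trans (shrinks y∈X y≢x) (s≤s⁻¹ fuel))
             (△-⊆ (△-⊆ X⊆D (⁅x⁆⊆ (X⊆D x∈X))) (⁅x⁆⊆ (X⊆D y∈X)))
             (∉-△ (∉-△ a∉X (a∉X ∘ ⁅x⁆⊆ x∈X)) (a∉X ∘ ⁅x⁆⊆ y∈X))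
             (s ≈> solve 4 (λ a s x y → ((a :△ s) :△ x) :△ y := a :△ ((s :△ x) :△ y))
                     refl ⁅ a ⁆ X ⁅ x ⁆ _)))
      where
      x≢a′ : x ≢ a
      x≢a′ refl = a∉X x∈X
      shrinks : ∀ {y} → y ∈ X → y ≢ x → ∣ X △ ⁅ x ⁆ △ ⁅ y ⁆ ∣ < ∣ X ∣
      shrinks y∈X y≢x =
        ≤-trans (≤-reflexive (∣△⁅x⁆∣-∈ (X △ ⁅ x ⁆) (∈-△ˡ y∈X (x≢y⇒x∉⁅y⁆ y≢x))))
                (≤-trans (ℕ.n≤1+n _) (≤-reflexive (∣△⁅x⁆∣-∈ X x∈X)))
      parity-X : ∀ y → parity (X △ ⁅ x ⁆ △ ⁅ y ⁆) ≡ parity X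
      parity-X y = trans (parity-△⁅⁆ (X △ ⁅ x ⁆) y)
                             (trans (cong not (parity-△⁅⁆ X x)) (Bool.not-involutive _))

    -- Removing `a` from the members `D` and `D △ ⁅ q ⁆` gives two sets that `even` declares even,
    -- yet their sizes differ by one.
    all-Q-absurd : ∀ {q} → q ∈ D → q ≢ a → D △ ⁅ q ⁆ ∉ˢ F
    all-Q-absurd {q} q∈D q≢a D△q∈F =
      contradiction (trans (sym even₂) (trans (parity-△⁅⁆ (D △ ⁅ a ⁆) q) (cong not even₁))) λ ()
      where
      D∖a⊆D : D △ ⁅ a ⁆ ⊆ D
      D∖a⊆D = △-⊆ id (⁅x⁆⊆ a∈D)
      a∉D∖a : a ∉ D △ ⁅ a ⁆
      a∉D∖a = ∈⇒∉-△ a∈D (x∈⁅x⁆ a)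
      even₁ : parity (D △ ⁅ a ⁆) ≡ false
      even₁ = even _ (n<1+n _) D∖a⊆D a∉D∖a
                (D∈F ≈> solve 2 (λ d a → d := a :△ (d :△ a)) refl D ⁅ a ⁆)
      even₂ : parity (D △ ⁅ a ⁆ △ ⁅ q ⁆) ≡ false
      even₂ = even _ (n<1+n _) (△-⊆ D∖a⊆D (⁅x⁆⊆ q∈D)) (∉-△ a∉D∖a (x≢y⇒x∉⁅y⁆ (q≢a ∘ sym)))
                (D△q∈F ≈> solve 3 (λ d a q → d :△ q := a :△ ((d :△ a) :△ q)) refl D ⁅ a ⁆ ⁅ q ⁆)

  -- The partner `y` of `q`, outside Q or in Q.

  module _ (3<∣D∣ : 3 < ∣ D ∣) {q y : Fin n} (q∈Q : InQ q) (y∈D : y ∈ D) (y≢a : y ≢ a) (y≢q : y ≢ q)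
    (aqy∈F : ⁅ a ⁆ △ ⁅ q ⁆ △ ⁅ y ⁆ ∈ˢ F) (D△qy∈F : D △ (⁅ q ⁆ △ ⁅ y ⁆) ∈ˢ F) where

    private
      qy : Subset n
      qy = ⁅ q ⁆ △ ⁅ y ⁆

      q∈qy : q ∈ qy
      q∈qy = ∈-△ˡ (x∈⁅x⁆ q) (x≢y⇒x∉⁅y⁆ (y≢q ∘ sym))

      ∣qy∣≤2 : ∣ qy ∣ ≤ 2
      ∣qy∣≤2 = ≤-trans (∣△⁅x⁆∣-≤ ⁅ q ⁆ y) (s≤s (≤-reflexive (∣⁅x⁆∣≡1 q)))

    -- Runs `raise` and `swap` on `qy`. As `y` is not in Q, the swap gives up `q` and leaves a
    -- removable set, `y` with `R`, that misses Q.
    ¬Qy-absurd : ¬ ¬ Q y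
    ¬Qy-absurd ¬Qy =
      let R , m , p , s = raise qy-removable (q , q∈qy) in continue m p s (_ ℕ.<? _)
      where
      qy-removable : Removable qy
      qy-removable = removable (△-⊆ (⁅x⁆⊆ (x∈D q∈Q)) (⁅x⁆⊆ y∈D))
        (∉-△ (x≢y⇒x∉⁅y⁆ (x≢a q∈Q ∘ sym)) (x≢y⇒x∉⁅y⁆ (y≢a ∘ sym))) D△qy∈F

      continue : ∀ {R} → Mate (D △ qy) a R → ⁅ a ⁆ △ R ∈ˢ F → D △ (qy △ ⁅ a ⁆ △ R) ∈ˢ F →
        Dec (∣ qy △ ⁅ a ⁆ △ R ∣ < ∣ D ∣) → ⊥₀
      continue {R} m p s (yes small) =
        let _ , q′∈qy , Qq′ , rest = swap qy-removable m p s small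
        in removable-meets-Q (rest-removable q′∈qy Qq′ rest) (y , ∈-△ˡ (x∈⁅x⁆ y) y∉R)
             (subst (_< ∣ D ∣) ∣qyaR∣ small) ¬Q-rest
        where
        rest-removable : ∀ {q′} → q′ ∈ qy → Q q′ → Removable (qy △ ⁅ q′ ⁆ △ R) → Removable (⁅ y ⁆ △ R)
        rest-removable q′∈ Qq′ rest with ∈-△⇒∈⊎∈ q′∈
        ... | inj₁ q′∈q with refl ← x∈⁅y⁆⇒x≡y q q′∈q =
          subst Removable (solve 3 (λ q y r → ((q :△ y) :△ q) :△ r := y :△ r) refl ⁅ q ⁆ ⁅ y ⁆ R) rest
        ... | inj₂ q′∈y with refl ← x∈⁅y⁆⇒x≡y y q′∈y = contradiction Qq′ ¬Qy
        R-avoids : ∀ {x} → x ∈ R → x ∉ qy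
        R-avoids x∈R = proj₂ (∈-∖⁻ (g⊆D qy-removable) (proj₁ (mate-∈ m x∈R)))
        y∉R : y ∉ R
        y∉R y∈R = R-avoids y∈R (∈-△ʳ (x≢y⇒x∉⁅y⁆ y≢q) (x∈⁅x⁆ y))
        q∉ : q ∉ ⁅ y ⁆ △ R
        q∉ = ∉-△ (x≢y⇒x∉⁅y⁆ (y≢q ∘ sym)) (λ q∈R → R-avoids q∈R q∈qy)
        a∉ : a ∉ ⁅ y ⁆ △ R △ ⁅ q ⁆
        a∉ = ∉-△ (∉-△ (x≢y⇒x∉⁅y⁆ (y≢a ∘ sym)) (a∉mate m)) (x≢y⇒x∉⁅y⁆ (x≢a q∈Q ∘ sym))
        ∣qyaR∣ : ∣ qy △ ⁅ a ⁆ △ R ∣ ≡ 2 + ∣ ⁅ y ⁆ △ R ∣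
        ∣qyaR∣ = trans
          (cong ∣_∣ (solve 4 (λ q y a r → ((q :△ y) :△ a) :△ r := ((y :△ r) :△ q) :△ a)
                       refl ⁅ q ⁆ ⁅ y ⁆ ⁅ a ⁆ R))
          (trans (∣△⁅x⁆∣-∉ (⁅ y ⁆ △ R △ ⁅ q ⁆) a∉) (cong suc (∣△⁅x⁆∣-∉ (⁅ y ⁆ △ R) q∉)))
        ¬Q-rest : ∀ {x} → x ∈ ⁅ y ⁆ △ R → ¬ Q x
        ¬Q-rest x∈ with ∈-△⇒∈⊎∈ x∈
        ... | inj₁ x∈y with refl ← x∈⁅y⁆⇒x≡y y x∈y = ¬Qy
        ... | inj₂ x∈R = mate⇒¬Q (mate⊆ (g⊆D qy-removable) m) p x∈R
      continue alone _ _ (no ≮) = ≮ (≤-<-trans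
        (≤-trans (≤-reflexive (cong ∣_∣ (△-⊥ (qy △ ⁅ a ⁆)))) (≤-trans (∣△⁅x⁆∣-≤ qy a) (s≤s ∣qy∣≤2)))
        3<∣D∣)
      -- Here `D` consists of `a`, `q`, `y`, `r`, so `aqy∈F` says that `⁅ r ⁆` is removable,
      -- although `r` is in P and hence not in Q.
      continue m@(mate {r} r∈ r≢a) p _ (no ≮) =
        removable-meets-Q (removable (⁅x⁆⊆ r∈D) (x≢y⇒x∉⁅y⁆ (r≢a ∘ sym)) D△r∈F) (r , x∈⁅x⁆ r)
          (subst (λ k → 2 + k < ∣ D ∣) (sym (∣⁅x⁆∣≡1 r)) 3<∣D∣)
          (mate⇒¬Q (mate⊆ (g⊆D qy-removable) m) p)
        where
        r∈D : r ∈ D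
        r∈D = proj₁ (∈-∖⁻ (g⊆D qy-removable) r∈)
        qyar≡D : qy △ ⁅ a ⁆ △ ⁅ r ⁆ ≡ D
        qyar≡D = ⊆∧≮⇒≡ _ D (△-⊆ (△-⊆ (g⊆D qy-removable) (⁅x⁆⊆ a∈D)) (⁅x⁆⊆ r∈D)) ≮
        D△r∈F : D △ ⁅ r ⁆ ∈ˢ F
        D△r∈F = aqy∈F ≈> trans
          (solve 4 (λ a q y r → (a :△ q) :△ y := (((q :△ y) :△ a) :△ r) :△ r)
             refl ⁅ a ⁆ ⁅ q ⁆ ⁅ y ⁆ ⁅ r ⁆)
          (cong (_△ ⁅ r ⁆) qyar≡D)

    -- Exchanging `a` between `⊥` and the triple deletes `a` alone, as a partner would be in both P
    -- and Q. So `qy` is a member from which `Q-spreads` can start.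
    Qy-absurd : ⁅ a ⁆ ∈ˢ F → D △ ⁅ q ⁆ ∈ˢ F → ¬ Q y
    Qy-absurd a∈F D△q∈F Qy =
      exchange-cases ⊥ (qy △ ⁅ a ⁆) ∅∈F
        (aqy∈F ≈> solve 3 (λ a q y → (a :△ q) :△ y := :⊥ :△ ((q :△ y) :△ a)) refl ⁅ a ⁆ ⁅ q ⁆ ⁅ y ⁆)
        (≤-<-trans (≤-trans (∣△⁅x⁆∣-≤ qy a) (s≤s ∣qy∣≤2)) 3<∣D∣)
        (∈-△ʳ (λ a∈qy → x≢a (qy⊆Q a∈qy) refl) (x∈⁅x⁆ a))
        (λ _ s →
          let qy∈F = s ≈> solve 2 (λ h a → (:⊥ :△ (h :△ a)) :△ a := h) refl qy ⁅ a ⁆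
          in all-Q-absurd a∈F (Q-spreads _ (n<1+n _) qy∈F (q , q∈qy) qy⊆Q)
               (x∈D q∈Q) (x≢a q∈Q) D△q∈F)
        (λ {z} z∈ z≢a p _ →
          let z∈Q = qy⊆Q (∈-△-∉ʳ z∈ (x≢y⇒x∉⁅y⁆ z≢a))
          in clash (mate (x∈D z∈Q) z≢a)
               (p ≈> solve 2 (λ a z → (:⊥ :△ a) :△ z := a :△ z) refl ⁅ a ⁆ ⁅ z ⁆) (Qx z∈Q))
      where
      qy⊆Q : ∀ {x} → x ∈ qy → InQ x
      qy⊆Q = adjoin (λ x∈q → subst InQ (sym (x∈⁅y⁆⇒x≡y q x∈q)) q∈Q) (inQ y∈D y≢a Qy)

  -- Exchanges `q` between `⁅ a ⁆` and `D`. A partner `y` is forced, since `q` alone would be in P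
  -- as well as Q.
  absurd : ∀ {g} → Removable g → Nonempty g → ¬ 2 + ∣ g ∣ < ∣ D ∣
  absurd {g} rg (x , x∈g) small =
    let a∈F , q , q∈D , q≢a , Qq , D△q∈F = removable-singleton _ (n<1+n _) rg (x , x∈g) small
        3<∣D∣ = ≤-<-trans (s≤s (s≤s (∈⇒0<∣∣ g x∈g))) small
    in exchange-cases ⁅ a ⁆ (D △ ⁅ a ⁆) a∈F
         (D∈F ≈> solve 2 (λ d a → d := a :△ (d :△ a)) refl D ⁅ a ⁆)
         (∣∖∣-< ⁅ a ⁆ D (⁅x⁆⊆ a∈D) (x∈⁅x⁆ a))
         (∈-△ˡ q∈D (x≢y⇒x∉⁅y⁆ q≢a))
         (λ p _ → clash (mate q∈D q≢a) p Qq)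
         (λ {y} y∈ y≢q aqy∈F s →
           let y∈D , y∉a = ∈-∖⁻ (⁅x⁆⊆ a∈D) y∈
               y≢a = x∉⁅y⁆⇒x≢y y∉a
               D△qy∈F = s ≈> solve 4 (λ d a q y → ((a :△ (d :△ a)) :△ q) :△ y := d :△ (q :△ y))
                                refl D ⁅ a ⁆ ⁅ q ⁆ ⁅ y ⁆
               q∈Q = inQ q∈D q≢a Qq
           in ¬Qy-absurd 3<∣D∣ q∈Q y∈D y≢a y≢q aqy∈F D△qy∈F
                (Qy-absurd 3<∣D∣ q∈Q y∈D y≢a y≢q aqy∈F D△qy∈F a∈F D△q∈F))

-- From peers to simultaneous exchange.

module _ {n : ℕ} where

  -- The antipodes of the cube of `A` and `A △ D` are the pairs `A △ S`, `A △ D △ S` with `S ⊆ D`;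
  -- `⊥` and `D` give back the original pair.
  Peered : SetSystem n → Set
  Peered F = ∀ A D → A ∈ˢ F → A △ D ∈ˢ F → 3 ≤ ∣ D ∣ →
    Σ[ S ∈ Subset n ] (S ⊆ D × S ≢ ⊥ × S ≢ D × A △ S ∈ˢ F × A △ D △ S ∈ˢ F)

  peered-twist : ∀ A {F} → Peered F → Peered (twist A F)
  peered-twist A {F} peered B D B∈ BD∈ 3≤∣D∣ =
    let S , S⊆D , S≢⊥ , S≢D , p , q = peered (A △ B) D B∈
          (subst (_∈ˢ F) (solve 3 (λ a b d → a :△ (b :△ d) := (a :△ b) :△ d) refl A B D) BD∈) 3≤∣D∣
    in S , S⊆D , S≢⊥ , S≢D
      , subst (_∈ˢ F) (solve 3 (λ a b s → (a :△ b) :△ s := a :△ (b :△ s)) refl A B S) p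
      , subst (_∈ˢ F) (solve 4 (λ a b d s → ((a :△ b) :△ d) :△ s := a :△ ((b :△ d) :△ s))
                         refl A B D S) q

  ∣∣≤0⇒≡⊥ : (S : Subset n) → ∣ S ∣ ≤ 0 → S ≡ ⊥
  ∣∣≤0⇒≡⊥ S ∣S∣≤0 = Empty-unique λ (_ , x∈S) → ℕ.<⇒≱ (∈⇒0<∣∣ S x∈S) ∣S∣≤0

  ∣∣≤2⇒pair : ∀ (S : Subset n) {a} → a ∈ S → ∣ S ∣ ≤ 2 → Σ[ R ∈ Subset n ] (Mate S a R × S ≡ ⁅ a ⁆ △ R)
  ∣∣≤2⇒pair S {a} a∈S ∣S∣≤2 with nonempty? (S △ ⁅ a ⁆)
  ... | no empty = ⊥ , alone , trans
        (solve 2 (λ s a → s := (s :△ a) :△ a) refl S ⁅ a ⁆)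
        (trans (cong (_△ ⁅ a ⁆) (Empty-unique empty)) (solve 1 (λ a → :⊥ :△ a := a :△ :⊥) refl ⁅ a ⁆))
  ... | yes (r , r∈) = ⁅ r ⁆ , mate (proj₁ (∈-∖⁻ (⁅x⁆⊆ a∈S) r∈)) (x∉⁅y⁆⇒x≢y (proj₂ (∈-∖⁻ (⁅x⁆⊆ a∈S) r∈)))
        , trans (solve 3 (λ s a r → s := ((s :△ a) :△ r) :△ (a :△ r)) refl S ⁅ a ⁆ ⁅ r ⁆)
          (trans (cong (_△ (⁅ a ⁆ △ ⁅ r ⁆)) (∣∣≤0⇒≡⊥ (S △ ⁅ a ⁆ △ ⁅ r ⁆) ∣rest∣≤0))
                 (solve 1 (λ e → :⊥ :△ e := e) refl (⁅ a ⁆ △ ⁅ r ⁆)))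
    where
    ∣rest∣≤0 : ∣ S △ ⁅ a ⁆ △ ⁅ r ⁆ ∣ ≤ 0
    ∣rest∣≤0 = s≤s⁻¹ (s≤s⁻¹ (subst (_≤ 2)
      (sym (trans (cong suc (∣△⁅x⁆∣-∈ (S △ ⁅ a ⁆) r∈)) (∣△⁅x⁆∣-∈ S a∈S))) ∣S∣≤2))

  module _ (F : SetSystem n) (D : Subset n) (a : Fin n)
    -- Quantified over the system because it is applied to `twist D F` as well as to `F`.
    (exchange : ∀ {F} → Peered F → ∀ A E {x} →
       A ∈ˢ F → A △ E ∈ˢ F → ∣ E ∣ < ∣ D ∣ → x ∈ E → Exchange F A E x)
    (peered : Peered F) (∅∈F : ⊥ ∈ˢ F) (D∈F : D ∈ˢ F) (a∈D : a ∈ D)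
    (clash : ∀ {R} → Mate D a R → ⁅ a ⁆ △ R ∈ˢ F → D △ ⁅ a ⁆ △ R ∉ˢ F)
    where

    private
      small-absurd : ∀ {S} → S ⊆ D → a ∈ S → S ∈ˢ F → D △ S ∈ˢ F → ¬ ∣ S ∣ ≤ 2
      small-absurd {S} S⊆D a∈S S∈F D△S∈F ∣S∣≤2 =
        let R , m , S≡ = ∣∣≤2⇒pair S a∈S ∣S∣≤2
        in clash (mate-mono S⊆D m) (subst (_∈ˢ F) S≡ S∈F)
             (subst (_∈ˢ F) (trans (cong (D △_) S≡)
                (solve 3 (λ d a r → d :△ (a :△ r) := (d :△ a) :△ r) refl D ⁅ a ⁆ R)) D△S∈F)

      peer-absurd : ∀ {S} → S ⊆ D → a ∈ S → S ≢ D → S ∈ˢ F → ¬ D △ S ∈ˢ F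
      peer-absurd {S} S⊆D a∈S S≢D S∈F g∈F with ∣ S ∣ ℕ.≤? 2
      ... | yes ∣S∣≤2 = small-absurd S⊆D a∈S S∈F g∈F ∣S∣≤2
      ... | no  ∣S∣≰2 = continue (D △ ⁅ a ⁆ ∈ˢ? F)
        where
        g : Subset n
        g = D △ S

        g⊆D : g ⊆ D
        g⊆D = △-⊆ id S⊆D

        nonempty : Nonempty g
        nonempty with nonempty? g
        ... | yes ne    = ne
        ... | no  empty = contradiction
          (trans (solve 2 (λ s d → s := d :△ (d :△ s)) refl S D)
                 (trans (cong (D △_) (Empty-unique empty)) (△-⊥ D))) S≢D

        ∣g∣ : 2 + ∣ g ∣ < ∣ D ∣
        ∣g∣ = ≤-trans (ℕ.+-monoˡ-≤ ∣ g ∣ (≰⇒> ∣S∣≰2))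
                      (≤-reflexive (trans (ℕ.+-comm ∣ S ∣ ∣ g ∣) (∣∖∣ S⊆D)))

        -- Complementation in D exchanges the roles of the two ends.
        continue : Dec (D △ ⁅ a ⁆ ∈ˢ F) → ⊥₀
        continue (no D△a∉F) =
          C.absurd (C.removable g⊆D (∈⇒∉-△ a∈D a∈S) (subst (_∈ˢ F) (sym (△-cancel D S)) S∈F)) nonempty ∣g∣
          where module C = Counterexample F D a (exchange peered) ∅∈F D∈F a∈D clash D△a∉F
        continue (yes D△a∈F) =
          C.absurd (C.removable g⊆D (∈⇒∉-△ a∈D a∈S) (subst (_∈ˢ F) (sym (△-cancel D g)) g∈F)) nonempty ∣g∣
          where
          clash′ : ∀ {R} → Mate D a R → ⁅ a ⁆ △ R ∈ˢ twist D F → D △ ⁅ a ⁆ △ R ∉ˢ twist D F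
          clash′ {R} m p q = clash m
            (subst (_∈ˢ F) (solve 3 (λ d a r → d :△ ((d :△ a) :△ r) := a :△ r) refl D ⁅ a ⁆ R) q)
            (subst (_∈ˢ F) (solve 3 (λ d a r → d :△ (a :△ r) := (d :△ a) :△ r) refl D ⁅ a ⁆ R) p)
          -- `⁅ a ⁆` and `D △ ⁅ a ⁆` both in `F` would be an exchange of `a` alone.
          D△a∉ : D △ ⁅ a ⁆ ∉ˢ twist D F
          D△a∉ p = clash alone
            (subst (_∈ˢ F) (solve 2 (λ d a → d :△ (d :△ a) := a :△ :⊥) refl D ⁅ a ⁆) p)
            (subst (_∈ˢ F) (sym (△-⊥ _)) D△a∈F)
          module C = Counterexample (twist D F) D a (exchange (peered-twist D peered))
            (subst (_∈ˢ F) (sym (△-⊥ D)) D∈F)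
            (subst (_∈ˢ F) (solve 1 (λ d → :⊥ := d :△ d) refl D) ∅∈F) a∈D clash′ D△a∉

    no-counterexample : ⊥₀
    no-counterexample with ∣ D ∣ ℕ.≤? 2
    -- A `D` of at most two elements can be exchanged as a whole.
    ... | yes ∣D∣≤2 = small-absurd id a∈D D∈F (subst (_∈ˢ F) (solve 1 (λ d → :⊥ := d :△ d) refl D) ∅∈F) ∣D∣≤2
    ... | no  ∣D∣≰2 =
      let S , S⊆D , S≢⊥ , S≢D , p , q = peered ⊥ D ∅∈F
            (subst (_∈ˢ F) (solve 1 (λ d → d := :⊥ :△ d) refl D) D∈F) (≰⇒> ∣D∣≰2)
          S∈F = subst (_∈ˢ F) (solve 1 (λ s → :⊥ :△ s := s) refl S) p
          D△S∈F = subst (_∈ˢ F) (solve 2 (λ d s → (:⊥ :△ d) :△ s := d :△ s) refl D S) q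
      in choose S⊆D S≢⊥ S≢D S∈F D△S∈F (a ∈? S)
      where
      -- Of `S` and its complement in `D`, the one containing `a` is used.
      choose : ∀ {S} → S ⊆ D → S ≢ ⊥ → S ≢ D → S ∈ˢ F → D △ S ∈ˢ F → Dec (a ∈ S) → ⊥₀
      choose     S⊆D _   S≢D S∈F D△S∈F (yes a∈S) = peer-absurd S⊆D a∈S S≢D S∈F D△S∈F
      choose {S} S⊆D S≢⊥ _   S∈F D△S∈F (no  a∉S) =
        peer-absurd (△-⊆ id S⊆D) (∈-△ˡ a∈D a∉S) D△S≢D D△S∈F
          (subst (_∈ˢ F) (sym (△-cancel D S)) S∈F)
        where
        D△S≢D : D △ S ≢ D
        D△S≢D D△S≡D = S≢⊥ (trans (sym (△-cancel D S))
          (trans (cong (D △_) D△S≡D) (solve 1 (λ d → d :△ d := :⊥) refl D)))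

  -- A finite search decides whether a partner exists; if not, twisting by `A` gives a
  -- counterexample, and the recursive call handles its smaller differences.
  simultaneous-exchange : ∀ k {F} → Peered F → ∀ A D {a} →
    A ∈ˢ F → A △ D ∈ˢ F → ∣ D ∣ < k → a ∈ D → Exchange F A D a
  simultaneous-exchange (suc k) {F} peered A D {a} A∈F AD∈F fuel a∈D
    with anyMate? (λ R → (A △ ⁅ a ⁆ △ R ∈ˢ? F) ×-dec (A △ D △ ⁅ a ⁆ △ R ∈ˢ? F))
  ... | yes e = e
  ... | no ¬e = ⊥-elim (no-counterexample (twist A F) D a
      (λ peered A E p q small → simultaneous-exchange k peered A E p q (<-≤-trans small (s≤s⁻¹ fuel)))
      (peered-twist A peered) (subst (_∈ˢ F) (sym (△-⊥ A)) A∈F) AD∈F a∈D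
      (λ {R} m p q → ¬e (R , m
        , subst (_∈ˢ F) (solve 3 (λ x a r → x :△ (a :△ r) := (x :△ a) :△ r) refl A ⁅ a ⁆ R) p
        , subst (_∈ˢ F) (solve 4 (λ x d a r → x :△ ((d :△ a) :△ r) := ((x :△ d) :△ a) :△ r)
                           refl A D ⁅ a ⁆ R) q)))

  -- Back to the definitions of strong and peerless.

  pair≡△ : {a b : Fin n} → a ≢ b → ⁅_,_⁆ a b ≡ ⁅ a ⁆ △ ⁅ b ⁆
  pair≡△ {a} {b} a≢b = ⊆-antisym
    (λ x∈ → [ (λ x∈a → ∈-△ˡ x∈a (λ x∈b → a≢b (trans (sym (x∈⁅y⁆⇒x≡y a x∈a)) (x∈⁅y⁆⇒x≡y b x∈b))))
            , (λ x∈b → ∈-△ʳ (λ x∈a → a≢b (trans (sym (x∈⁅y⁆⇒x≡y a x∈a)) (x∈⁅y⁆⇒x≡y b x∈b))) x∈b)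
            ]′ (x∈p∪q⁻ ⁅ a ⁆ ⁅ b ⁆ x∈))
    (λ x∈ → x∈p∪q⁺ (∈-△⇒∈⊎∈ x∈))

  mate⇒pair : ∀ {D a R} → a ∈ D → Mate D a R → Σ[ b ∈ Fin n ] (b ∈ D × ⁅ a ⁆ △ R ≡ ⁅_,_⁆ a b)
  mate⇒pair {a = a} a∈D alone              = a , a∈D , trans (△-⊥ ⁅ a ⁆) (sym (∪-idem ⁅ a ⁆))
  mate⇒pair         _   (mate {r} r∈D r≢a) = r , r∈D , sym (pair≡△ (r≢a ∘ sym))

  ∣pair∣≤2 : (a b : Fin n) → ∣ ⁅_,_⁆ a b ∣ ≤ 2
  ∣pair∣≤2 a b with a Fin.≟ b
  ... | yes refl = ≤-trans (≤-reflexive (trans (cong ∣_∣ (∪-idem ⁅ a ⁆)) (∣⁅x⁆∣≡1 a))) (ℕ.n≤1+n 1)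
  ... | no  a≢b  = ≤-trans (≤-reflexive (cong ∣_∣ (pair≡△ a≢b)))
                           (≤-trans (∣△⁅x⁆∣-≤ ⁅ a ⁆ b) (s≤s (≤-reflexive (∣⁅x⁆∣≡1 a))))

  -- One partner serves both sets for every `a`: the first axiom keeps half of this, and hyperplane
  -- exchange starts from any element of `A △ B`.
  peered⇒strong : ∀ {M} → Peered M → IsStrongDeltaMatroid M
  peered⇒strong {M} peered = (λ A B A∈M B∈M a a∈ → let b , b∈ , p , _ = exchange A B A∈M B∈M a∈ in b , b∈ , p)
    , hyperplane
    where
    exchange : ∀ A B {a} → A ∈ˢ M → B ∈ˢ M → a ∈ A △ B →
      Σ[ b ∈ Fin n ] (b ∈ A △ B × A △ (⁅_,_⁆ a b) ∈ˢ M × B △ (⁅_,_⁆ a b) ∈ˢ M)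
    exchange A B {a} A∈M B∈M a∈ =
      let R , m , p , q = simultaneous-exchange _ peered A (A △ B) A∈M
            (subst (_∈ˢ M) (sym (△-cancel A B)) B∈M) (n<1+n _) a∈
          b , b∈ , ≡pair = mate⇒pair a∈ m
      in b , b∈
        , subst (_∈ˢ M) (trans (solve 3 (λ x a r → (x :△ a) :△ r := x :△ (a :△ r)) refl A ⁅ a ⁆ R)
                               (cong (A △_) ≡pair)) p
        , subst (_∈ˢ M) (trans (solve 4 (λ x y a r → ((x :△ (x :△ y)) :△ a) :△ r := y :△ (a :△ r))
                                  refl A B ⁅ a ⁆ R)
                               (cong (B △_) ≡pair)) q
    hyperplane : HyperplaneExchange M
    hyperplane A B A∈M B∈M A≢B with nonempty? (A △ B)
    ... | yes (a , a∈) = let b , b∈ , p , q = exchange A B A∈M B∈M a∈ in a , b , a∈ , b∈ , p , q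
    ... | no  empty    = contradiction
      (trans (sym (△-⊥ A)) (trans (cong (A △_) (sym (Empty-unique empty))) (△-cancel A B))) A≢B

  antipode⇒△-⊆ : ∀ {I J S T : Subset n} → IsAntipode I J S T → I △ S ⊆ I △ J
  antipode⇒△-⊆ {I} {J} {S} {T} (∩≡ , △≡) {x} x∈ with ∈-△⁻ I S x∈
  ... | inj₁ (x∈I , x∉S) = ∈-△ˡ x∈I λ x∈J →
        x∉S (proj₁ (x∈p∩q⁻ S T (subst (x ∈_) (sym ∩≡) (x∈p∩q⁺ (x∈I , x∈J)))))
  ... | inj₂ (x∉I , x∈S) = subst (x ∈_) △≡ (∈-△ˡ x∈S λ x∈T →
        x∉I (proj₁ (x∈p∩q⁻ I J (subst (x ∈_) ∩≡ (x∈p∩q⁺ (x∈S , x∈T))))))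

  -- The existence of `S` is decided by finite search; if it fails, `A` and `A △ D` form a peerless
  -- antipode.
  no-peerless⇒peered : ∀ {M} → (∀ k → k ≥ 3 → ¬ HasPeerlessAntipodeInCube M k) → Peered M
  no-peerless⇒peered {M} no-peerless A D A∈M AD∈M 3≤∣D∣
    with anySubset? (λ S → (S ⊆? D) ×-dec ¬? (S ≟ˢ ⊥) ×-dec ¬? (S ≟ˢ D)
                           ×-dec (A △ S ∈ˢ? M) ×-dec (A △ D △ S ∈ˢ? M))
  ... | yes S = S
  ... | no ¬S = contradiction (A , A △ D , cong ∣_∣ (△-cancel A D) , A∈M , AD∈M , peerless)
                              (no-peerless ∣ D ∣ 3≤∣D∣)
    where
    peerless : ∀ S T → S ∈ˢ M → T ∈ˢ M → IsAntipode A (A △ D) S T → SamePair S T A (A △ D)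
    peerless S T S∈M T∈M antipode@(_ , △≡) = cases (S′ ≟ˢ ⊥) (S′ ≟ˢ D)
      where
      S′ : Subset n
      S′ = A △ S
      S≡ : ∀ {U} → S′ ≡ U → S ≡ A △ U
      S≡ S′≡U = trans (sym (△-cancel A S)) (cong (A △_) S′≡U)
      T≡ : T ≡ A △ D △ S′
      T≡ = trans (sym (△-cancel S T)) (trans (cong (S △_) △≡)
             (solve 3 (λ a d s → s :△ (a :△ (a :△ d)) := (a :△ d) :△ (a :△ s)) refl A D S))
      cases : Dec (S′ ≡ ⊥) → Dec (S′ ≡ D) → SamePair S T A (A △ D)
      cases (yes S′≡⊥) _ = inj₁ (trans (S≡ S′≡⊥) (△-⊥ A)
        , trans T≡ (trans (cong (A △ D △_) S′≡⊥) (△-⊥ (A △ D))))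
      cases (no _) (yes S′≡D) = inj₂ (S≡ S′≡D
        , trans T≡ (trans (cong (A △ D △_) S′≡D) (solve 2 (λ a d → (a :△ d) :△ d := a) refl A D)))
      cases (no S′≢⊥) (no S′≢D) = contradiction
        (S′ , (λ {x} x∈ → subst (x ∈_) (△-cancel A D) (antipode⇒△-⊆ antipode x∈)) , S′≢⊥ , S′≢D
         , subst (_∈ˢ M) (S≡ refl) S∈M , subst (_∈ˢ M) T≡ T∈M) ¬S

-- Hyperplane exchange excludes peerless antipodes.

∩-flip : ∀ {n} (I J E : Subset n) → E ⊆ I △ J → (I △ E) ∩ (J △ E) ≡ I ∩ J
∩-flip []          []          []          _  = refl
∩-flip (i ∷ I)     (j ∷ J)     (false ∷ E) E⊆ =
  cong₂ _∷_ (cong₂ _∧_ (Bool.xor-identityʳ i) (Bool.xor-identityʳ j)) (∩-flip I J E (drop-∷-⊆ E⊆))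
-- Where `E` flips, `I` and `J` differ, so both intersections miss the coordinate.
∩-flip (false ∷ I) (true  ∷ J) (true  ∷ E) E⊆ = cong (false ∷_) (∩-flip I J E (drop-∷-⊆ E⊆))
∩-flip (true  ∷ I) (false ∷ J) (true  ∷ E) E⊆ = cong (false ∷_) (∩-flip I J E (drop-∷-⊆ E⊆))
∩-flip (false ∷ _) (false ∷ _) (true  ∷ _) E⊆ with () ← E⊆ here
∩-flip (true  ∷ _) (true  ∷ _) (true  ∷ _) E⊆ with () ← E⊆ here

-- The exchange yields another antipode: `I △ E` is not `I` because `E` is nonempty, and not `J`
-- because `E` has at most two elements and `I △ J` at least three.
hyperplane⇒no-peerless : ∀ {n} {M : SetSystem n} → HyperplaneExchange M →
  ∀ k → k ≥ 3 → ¬ HasPeerlessAntipodeInCube M k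
hyperplane⇒no-peerless {n} {M} he _ k≥3 (I , J , refl , I∈M , J∈M , peerless) =
  let a , b , a∈ , b∈ , p , q = he I J I∈M J∈M I≢J
      E = ⁅_,_⁆ a b
      E⊆ = λ {x} (x∈ : x ∈ E) → [ ⁅x⁆⊆ a∈ , ⁅x⁆⊆ b∈ ]′ (x∈p∪q⁻ ⁅ a ⁆ ⁅ b ⁆ x∈)
      a∈E = x∈p∪q⁺ {p = ⁅ a ⁆} {q = ⁅ b ⁆} (inj₁ (x∈⁅x⁆ a))
      E≡ = λ {S} (I△E≡S : I △ E ≡ S) → trans (sym (△-cancel I E)) (cong (I △_) I△E≡S)
  in [ (λ (I△E≡I , _) → ∉⊥ (subst (a ∈_) (trans (E≡ I△E≡I) △-self) a∈E))
     , (λ (I△E≡J , _) → ℕ.<⇒≱ k≥3 (≤-trans (≤-reflexive (cong ∣_∣ (sym (E≡ I△E≡J)))) (∣pair∣≤2 a b)))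
     ]′ (peerless (I △ E) (J △ E) p q
           (∩-flip I J E E⊆ , solve 3 (λ i j e → (i :△ e) :△ (j :△ e) := i :△ j) refl I J E))
  where
  △-self : I △ I ≡ ⊥
  △-self = solve 1 (λ i → i :△ i := :⊥) refl I
  I≢J : I ≢ J
  I≢J refl = ℕ.<⇒≱ k≥3 (≤-trans (≤-reflexive (trans (cong ∣_∣ △-self) (∣⊥∣≡0 n))) z≤n)

theorem3p13 : ∀ (n : ℕ) (M : SetSystem n) →
    IsStrongDeltaMatroid M ⇔ (∀ (k : ℕ) → k ≥ 3 → ¬ HasPeerlessAntipodeInCube M k)
theorem3p13 n M = mk⇔ (hyperplane⇒no-peerless ∘ proj₂) (peered⇒strong ∘ no-peerless⇒peered)
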